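{- Let $t\geq 1$ be an integer. If $G$ is a connected $K_{2,t}$-minor-free graph, then $c(G)\leq \left\lceil\frac{t+1}{2}\right\rceil$.
   Context: All graphs are finite and simple. $K_{s,t}$ is the complete bipartite graph with parts of sizes $s$ and $t$. A graph $G$ is $H$-minor-free if no graph isomorphic to $H$ can be obtained from $G$ by deleting vertices, deleting edges and contracting edges. Cop number: in the game of cops and robbers on $G$, one player places $m$ cops on (not necessarily distinct) vertices, then the other player places the robber on a vertex. Then, starting with the cops, the players alternate turns; on a turn, a player may move any of their pieces to an adjacent vertex (each piece moves at most once, and any piece may stay put). The cops win if at some point some cop occupies the same vertex as the robber; the robber wins by evading capture forever. The cop number $c(G)$ is the minimum $m$ such that the cops have a winning strategy. -}

module Defs where

open import Data.Fin using (Fin; toℕ; punchIn; _≟_)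
open import Data.List using (List; []; _∷_)
open import Data.Nat using (ℕ; zero; suc; _+_; _≤_; _<_; _≤?_; _<?_)
open import Data.Nat.Properties using (<⇒≱)
open import Data.Product using (_×_; _,_; ∃-syntax; swap)
open import Data.Sum using (_⊎_; inj₁; inj₂) renaming (swap to ⊎-swap)
open import Data.Vec.Functional using (Vector)
open import Function using (_↔_; _⇔_; Inverse)
open import Level using (0ℓ)
open import Relation.Binary using (Rel; Symmetric; Irreflexive; Decidable)
open import Relation.Binary.Construct.Closure.ReflexiveTransitive using (Star)
open import Relation.Binary.PropositionalEquality using (_≡_; _≢_; refl; sym)
open import Relation.Nullary using (¬_; ¬?; _×-dec_; _⊎-dec_)

record Graph (n : ℕ) : Set₁ where
  infix 4 _~_ _~?_
  field
    _~_      : Rel (Fin n) 0ℓ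
    ~-sym    : Symmetric _~_
    ~-irrefl : Irreflexive _≡_ _~_
    _~?_     : Decidable _~_

-- The first s vertices form one part, the last t vertices the other.
K : (s t : ℕ) → Graph (s + t)
K s t = record
  { _~_      = λ i j → (toℕ i < s × s ≤ toℕ j) ⊎ (s ≤ toℕ i × toℕ j < s)
  ; ~-sym    = λ { (inj₁ e) → inj₂ (swap e) ; (inj₂ e) → inj₁ (swap e) }
  ; ~-irrefl = λ { refl (inj₁ (p , q)) → <⇒≱ p q ; refl (inj₂ (p , q)) → <⇒≱ q p }
  ; _~?_     = λ i j → ((toℕ i <? s) ×-dec (s ≤? toℕ j)) ⊎-dec ((s ≤? toℕ i) ×-dec (toℕ j <? s))
  }

-- Any two vertices are joined by a walk; the graph with no vertices is not excluded.
Connected : ∀ {n} → Graph n → Set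
Connected G = ∀ u v → Star _~_ u v
  where open Graph G

record _≅_ {m n} (G : Graph m) (H : Graph n) : Set where
  open Graph
  field
    bij      : Fin m ↔ Fin n
    preserve : ∀ u v → _~_ G u v ⇔ _~_ H (Inverse.to bij u) (Inverse.to bij v)

module _ {n} (G : Graph (suc n)) where
  open Graph G

  -- punchIn v enumerates the vertices other than v.
  deleteVertex : Fin (suc n) → Graph n
  deleteVertex v = record
    { _~_      = λ i j → punchIn v i ~ punchIn v j
    ; ~-sym    = ~-sym
    ; ~-irrefl = λ { refl e → ~-irrefl refl e }
    ; _~?_     = λ i j → punchIn v i ~? punchIn v j
    }

  -- The vertex u of the result represents the merged pair {u , v}, and v is
  -- removed; the condition i ≢ j discards loops, and parallel edges coincide
  -- because adjacency is a relation.
  contractEdge : (u v : Fin (suc n)) → u ~ v → Graph n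
  contractEdge u v _ = record
    { _~_      = λ i j → i ≢ j × (p i ~ p j ⊎ ((p i ≡ u × v ~ p j) ⊎ (p j ≡ u × v ~ p i)))
    ; ~-sym    = λ { (i≢j , inj₁ e) → (λ j≡i → i≢j (sym j≡i)) , inj₁ (~-sym e)
                   ; (i≢j , inj₂ e) → (λ j≡i → i≢j (sym j≡i)) , inj₂ (⊎-swap e) }
    ; ~-irrefl = λ i≡j e → let (i≢j , _) = e in i≢j i≡j
    ; _~?_     = λ i j → ¬? (i ≟ j) ×-dec
                   ((p i ~? p j) ⊎-dec
                     (((p i ≟ u) ×-dec (v ~? p j)) ⊎-dec ((p j ≟ u) ×-dec (v ~? p i))))
    }
    where
    p : Fin n → Fin (suc n)
    p = punchIn v

deleteEdge : ∀ {n} (G : Graph n) (u v : Fin n) → Graph._~_ G u v → Graph n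
deleteEdge G u v _ = record
  { _~_      = λ i j → i ~ j × (¬ (i ≡ u × j ≡ v) × ¬ (j ≡ u × i ≡ v))
  ; ~-sym    = λ { (e , ne) → ~-sym e , swap ne }
  ; ~-irrefl = λ { i≡j (e , _) → ~-irrefl i≡j e }
  ; _~?_     = λ i j → (i ~? j) ×-dec
                 (¬? ((i ≟ u) ×-dec (j ≟ v)) ×-dec ¬? ((j ≟ u) ×-dec (i ≟ v)))
  }
  where open Graph G

data _IsMinorOf_ {m} (H : Graph m) : ∀ {n} → Graph n → Set₁ where
  iso    : ∀ {n} {G : Graph n} → H ≅ G → H IsMinorOf G
  del-v  : ∀ {n} {G : Graph (suc n)} v →
           H IsMinorOf deleteVertex G v → H IsMinorOf G
  del-e  : ∀ {n} {G : Graph n} u v (e : Graph._~_ G u v) →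
           H IsMinorOf deleteEdge G u v e → H IsMinorOf G
  contr  : ∀ {n} {G : Graph (suc n)} u v (e : Graph._~_ G u v) →
           H IsMinorOf contractEdge G u v e → H IsMinorOf G

_-MinorFree_ : ∀ {m n} → Graph m → Graph n → Set₁
H -MinorFree G = ¬ (H IsMinorOf G)

module Game {n} (G : Graph n) where
  open Graph G

  Move : Rel (Fin n) 0ℓ
  Move u v = u ≡ v ⊎ u ~ v

  -- The robber's positions so far, most recent first, determine the history of
  -- a play against a fixed strategy: position [] is the initial placement of
  -- the cops and position (r ∷ h) their placement after answering r.
  record Strategy (m : ℕ) : Set where
    field
      position : List (Fin n) → Vector (Fin n) m
      legal    : ∀ r h i → Move (position h i) (position (r ∷ h) i)

  -- r 0 is the robber's initial vertex and r k the robber's vertex after k moves.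
  RobberPlay : (ℕ → Fin n) → Set
  RobberPlay r = ∀ k → Move (r k) (r (suc k))

  history : (ℕ → Fin n) → ℕ → List (Fin n)
  history r zero    = []
  history r (suc k) = r k ∷ history r k

  -- While the robber is at r k, the cops stand first at position (history r k)
  -- and, after their turn, at position (history r (suc k)).
  Captured : ∀ {m} → Strategy m → (ℕ → Fin n) → Set
  Captured σ r = ∃[ k ] ∃[ i ]
    (position (history r k) i ≡ r k ⊎ position (history r (suc k)) i ≡ r k)
    where open Strategy σ

  Winning : ∀ {m} → Strategy m → Set
  Winning σ = ∀ r → RobberPlay r → Captured σ r

  CopsWin : ℕ → Set
  CopsWin m = ∃[ σ ] Winning {m} σ

IsCopNumber : ∀ {n} → Graph n → ℕ → Set
IsCopNumber G c = CopsWin c × (∀ m → CopsWin m → c ≤ m)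
  where open Game G

{-# OPTIONS --safe #-}
-- Station the cops on a connected set X and let R, the territory of the robber,
-- be connected with all its outer neighbours adjacent to cops on X.  Contracting X
-- and R gives a K_{2,t} with the outer neighbours of R as the part of size t, so
-- there are fewer than t of them.  As m cops satisfy 2m ≥ t, some cop answers for
-- at most one outer neighbour y (or for none, and then y is any of them).  That cop
-- moves to y: the others still guard the rest, y joins X, and the robber is left in
-- a component of R minus the neighbourhood of y, which is strictly smaller.
module Submission where

open import Data.Bool using (if_then_else_)
open import Data.Fin using (Fin; zero; suc; punchIn; punchOut; splitAt; join; inject≤; finToFun; funToFin; fromℕ<; _≟_)
open import Data.Fin.Properties using
  (any?; all?; ¬∀⟶∃¬; punchIn-injective; punchInᵢ≢i; punchIn-punchOut; join-splitAt;
   inject≤-injective; finToFun-funToFin)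
open import Data.Fin.Subset using (Subset; _∈_; _∉_; _⊂_; _∪_; ⁅_⁆) renaming (⊥ to ∅)
open import Data.Fin.Subset.Induction using (Acc; acc; ⊂-wellFounded; ⊃-wellFounded)
open import Data.Fin.Subset.Properties using (_∈?_; ∉⊥; x∈⁅x⁆; x∈⁅y⁆⇒x≡y; x∈p∪q⁺; x∈p∪q⁻)
open import Data.List using (List; []; _∷_; allFin; cartesianProduct)
open import Data.List.Membership.Propositional.Properties using (∈-allFin; ∈-cartesianProduct⁺)
open import Data.List.Relation.Unary.Any using (here; there)
import Data.List.Membership.Propositional as List
open import Data.Maybe as Maybe using (Maybe; just; nothing)
open import Data.Nat using (ℕ; zero; suc; _+_; _^_; _≤_; z≤n; s≤s; ⌈_/2⌉; ⌊_/2⌋)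
open import Data.Nat.Properties using
  (m≤m+n; +-monoˡ-≤; ⌊n/2⌋≤⌈n/2⌉; ⌊n/2⌋+⌈n/2⌉≡n; ⌈n/2⌉-mono; module ≤-Reasoning)
open import Data.Product using (_×_; _,_; ∃; ∃-syntax; proj₁; proj₂)
open import Data.Sum using (_⊎_; inj₁; inj₂; [_,_]′)
open import Data.Vec.Functional using (Vector; updateAt) renaming (_∷_ to _∷ᵛ_)
open import Data.Vec.Functional.Properties using (updateAt-updates; updateAt-minimal)
open import Function using (_∘_; const; id; case_of_; _↔_; Inverse; mk⇔; mk↔ₛ′)
open import Function.Definitions using (Injective)
open import Level using (0ℓ)
open import Relation.Binary using (Rel)
open import Relation.Binary.Construct.Closure.ReflexiveTransitive as Star using (Star; ε; _◅_; _◅◅_)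
open import Relation.Binary.PropositionalEquality
  using (_≡_; _≢_; _≗_; refl; sym; trans; cong; subst; subst₂)
open import Relation.Nullary using (¬_; ¬?; Dec; yes; no; does; contradiction; _×-dec_; _⊎-dec_; _→-dec_)
open import Relation.Nullary.Decidable using (decidable-stable; map′; dec⇒maybe)
open import Relation.Unary using (Pred; Decidable)
open import Defs

-- Least witnesses and saturated sets

least : ∀ {P : Pred ℕ 0ℓ} → Decidable P → ∀ M → P M →
        ∃[ c ] (P c × (∀ m → P m → c ≤ m)) × c ≤ M
least P? zero    pM = zero , (pM , λ _ _ → z≤n) , z≤n
least P? (suc M) pM with P? zero
... | yes p0 = zero , (p0 , λ _ _ → z≤n) , z≤n
... | no ¬p0 with c , (pc , min) , c≤M ← least (P? ∘ suc) M pM =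
  suc c , (pc , λ { zero p0 → contradiction p0 ¬p0 ; (suc m) pm → s≤s (min m pm) }) , s≤s c≤M

-- Elements reachable by a step are added one at a time, which stops because a finite set has no
-- infinite strictly growing chain of subsets. Every addition preserves the invariant `Q`. Both
-- components and winning positions are computed this way.
saturate : ∀ {N} {Step : Subset N → Pred (Fin N) 0ℓ} {Q : Pred (Fin N) 0ℓ} →
           (∀ S → Decidable (Step S)) →
           (∀ S → (∀ {x} → x ∈ S → Q x) → ∀ {x} → Step S x → Q x) →
           ∃[ S ] (∀ {x} → x ∈ S → Q x) × (∀ {x} → Step S x → x ∈ S)
saturate {N} {Step} {Q} Step? sound = grow ∅ (⊃-wellFounded ∅) (λ x∈∅ → contradiction x∈∅ ∉⊥)
  where
  grow : ∀ S → Acc (λ T U → U ⊂ T) S → (∀ {x} → x ∈ S → Q x) →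
         ∃[ S ] (∀ {x} → x ∈ S → Q x) × (∀ {x} → Step S x → x ∈ S)
  grow S (acc rec) S⊆Q with any? (λ x → Step? S x ×-dec ¬? (x ∈? S))
  ... | no closed = S , S⊆Q , λ {x} st →
    decidable-stable (x ∈? S) (λ x∉S → closed (x , st , x∉S))
  ... | yes (x , st , x∉S) =
    grow (S ∪ ⁅ x ⁆)
         (rec ((λ y∈S → x∈p∪q⁺ (inj₁ y∈S)) , x , x∈p∪q⁺ (inj₂ (x∈⁅x⁆ x)) , x∉S))
         (λ y∈ → [ S⊆Q , (λ y∈x → subst Q (sym (x∈⁅y⁆⇒x≡y x y∈x)) (sound S S⊆Q st)) ]′
                   (x∈p∪q⁻ S ⁅ x ⁆ y∈))

-- Connected vertex sets and components

Within : ∀ {n} → Graph n → Pred (Fin n) 0ℓ → Rel (Fin n) 0ℓ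
Within G P u v = Graph._~_ G u v × P u × P v

within-sym : ∀ {n} (G : Graph n) {P u v} → Within G P u v → Within G P v u
within-sym G (e , pu , pv) = Graph.~-sym G e , pv , pu

ConnectedOn : ∀ {n} → Graph n → Pred (Fin n) 0ℓ → Set
ConnectedOn G P = ∀ {u v} → P u → P v → Star (Within G P) u v

hub⇒connectedOn : ∀ {n} (G : Graph n) {P : Pred (Fin n) 0ℓ} h →
                  (∀ {v} → P v → Star (Within G P) h v) → ConnectedOn G P
hub⇒connectedOn G h reach pu pv = Star.reverse (within-sym G) (reach pu) ◅◅ reach pv

-- The set is grown from `r`, each member carrying a walk from `r` inside `A`. The last clause is
-- maximality: outer neighbours of the component lie outside `A`.
component : ∀ {n} (G : Graph n) {A : Pred (Fin n) 0ℓ} → Decidable A → ∀ {r} → A r →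
            ∃[ S ] r ∈ S × (∀ {v} → v ∈ S → A v) × ConnectedOn G (_∈ S) ×
                   (∀ {u v} → u ∈ S → Graph._~_ G u v → A v → v ∈ S)
component {n} G {A} A? {r} Ar =
  S , closed (inj₁ refl) , proj₁ ∘ S⊆Q
    , hub⇒connectedOn G r (trace (closed (inj₁ refl)) ∘ proj₂ ∘ S⊆Q)
    , λ u∈S e Av → closed (inj₂ (Av , _ , u∈S , e))
  where
  open Graph G
  Step : Subset n → Pred (Fin n) 0ℓ
  Step S v = v ≡ r ⊎ (A v × ∃[ w ] w ∈ S × w ~ v)
  Q : Pred (Fin n) 0ℓ
  Q v = A v × Star (Within G A) r v
  Step? : ∀ S → Decidable (Step S)
  Step? S v = (v ≟ r) ⊎-dec (A? v ×-dec any? (λ w → (w ∈? S) ×-dec (w ~? v)))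
  sound : ∀ S → (∀ {x} → x ∈ S → Q x) → ∀ {x} → Step S x → Q x
  sound S S⊆Q (inj₁ refl) = Ar , ε
  sound S S⊆Q (inj₂ (Av , w , w∈S , e)) with Aw , ws ← S⊆Q w∈S = Av , ws ◅◅ ((e , Aw , Av) ◅ ε)
  saturated : ∃[ S ] (∀ {x} → x ∈ S → Q x) × (∀ {x} → Step S x → x ∈ S)
  saturated = saturate Step? sound
  S : Subset n
  S = proj₁ saturated
  S⊆Q : ∀ {x} → x ∈ S → Q x
  S⊆Q = proj₁ (proj₂ saturated)
  closed : ∀ {x} → Step S x → x ∈ S
  closed = proj₂ (proj₂ saturated)
  -- A walk in `A` that starts in the saturated set never leaves it.
  trace : ∀ {u v} → u ∈ S → Star (Within G A) u v → Star (Within G (_∈ S)) u v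
  trace u∈S ε = ε
  trace u∈S ((e , _ , Aw) ◅ ws) =
    let w∈S = closed (inj₂ (Aw , _ , u∈S , e)) in (e , u∈S , w∈S) ◅ trace w∈S ws

-- Minors from branch sets

record Model {k n} (H : Graph k) (G : Graph n) : Set₁ where
  private module H = Graph H
  open Graph G
  field
    part      : Fin k → Pred (Fin n) 0ℓ
    part?     : ∀ i → Decidable (part i)
    disjoint  : ∀ {i j v} → part i v → part j v → i ≡ j
    nonempty  : ∀ i → ∃ (part i)
    connected : ∀ i → ConnectedOn G (part i)
    edge      : ∀ {i j} → i H.~ j → ∃[ u ] ∃[ v ] part i u × part j v × u ~ v

-- Only surplus edges have to be deleted. `prune` runs through all ordered pairs and keeps the
-- invariant that every edge of the current graph either comes from `H` or is still on the list.
spanning⇒minor : ∀ {k n} (H : Graph k) (G : Graph n) (b : Fin k ↔ Fin n)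
  (let module H = Graph H; module G = Graph G; open Inverse b) →
  (∀ {i j} → i H.~ j → to i G.~ to j) → H IsMinorOf G
spanning⇒minor {k} H G₀ b fwd₀ =
  prune G₀ (cartesianProduct (allFin k) (allFin k)) fwd₀
    (λ _ → inj₂ (∈-cartesianProduct⁺ (∈-allFin _) (∈-allFin _)))
  where
  module H = Graph H
  open Inverse b using (to)
  to-injective : ∀ {i j} → to i ≡ to j → i ≡ j
  to-injective {i} {j} eq =
    trans (sym (Inverse.strictlyInverseʳ b i)) (trans (cong (Inverse.from b) eq) (Inverse.strictlyInverseʳ b j))
  prune : ∀ G (es : List (Fin k × Fin k)) (let module G = Graph G) →
          (∀ {i j} → i H.~ j → to i G.~ to j) →
          (∀ {i j} → to i G.~ to j → i H.~ j ⊎ (i , j) List.∈ es) → H IsMinorOf G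
  prune G [] fwd extra =
    iso (record { bij = b ; preserve = λ _ _ → mk⇔ fwd ([ id , (λ ()) ]′ ∘ extra) })
  prune G ((i , j) ∷ es) fwd extra with Graph._~?_ G (to i) (to j) | i H.~? j
  ... | no ¬e | _ = prune G es fwd λ e → case extra e of λ
    { (inj₁ h) → inj₁ h
    ; (inj₂ (here refl)) → contradiction e ¬e
    ; (inj₂ (there p)) → inj₂ p }
  ... | yes _ | yes h = prune G es fwd λ e → case extra e of λ
    { (inj₁ h′) → inj₁ h′
    ; (inj₂ (here refl)) → inj₁ h
    ; (inj₂ (there p)) → inj₂ p }
  ... | yes e | no ¬h = del-e (to i) (to j) e (prune (deleteEdge G (to i) (to j) e) es
    (λ {i′} {j′} h → fwd h
      , (λ (p , q) → ¬h (subst₂ H._~_ (to-injective p) (to-injective q) h))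
      , (λ (p , q) → ¬h (H.~-sym (subst₂ H._~_ (to-injective q) (to-injective p) h))))
    (λ (e′ , ne , _) → case extra e′ of λ
      { (inj₁ h) → inj₁ h
      ; (inj₂ (here refl)) → contradiction (refl , refl) ne
      ; (inj₂ (there p)) → inj₂ p }))

unpunch : ∀ {n} (v : Fin (suc n)) {w} → w ≢ v → ∃[ a ] punchIn v a ≡ w
unpunch v w≢v = punchOut (w≢v ∘ sym) , punchIn-punchOut (w≢v ∘ sym)

-- As `v` lies in no branch set, walks inside branch sets avoid it and lift along `punchIn v`.
model-deleteVertex : ∀ {k n} {H : Graph k} {G : Graph (suc n)} (M : Model H G) v →
  (∀ i → ¬ Model.part M i v) → Model H (deleteVertex G v)
model-deleteVertex {G = G} M v unused = record
  { part      = λ i a → part i (punchIn v a)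
  ; part?     = λ i a → part? i (punchIn v a)
  ; disjoint  = disjoint
  ; nonempty  = λ i → let _ , pw = nonempty i; a , eq = unpunch v (used pw) in
                      a , subst (part i) (sym eq) pw
  ; connected = λ i pa pb → restrict (connected i pa pb) refl refl
  ; edge      = edge′
  }
  where
  open Model M
  open Graph G
  used : ∀ {i w} → part i w → w ≢ v
  used pw refl = unused _ pw
  restrict : ∀ {i x y a b} → Star (Within G (part i)) x y → punchIn v a ≡ x → punchIn v b ≡ y →
             Star (Within (deleteVertex G v) (λ a → part i (punchIn v a))) a b
  restrict {a = a} {b} ε refl eq with refl ← punchIn-injective v b a eq = ε
  restrict ((e , pa , pw) ◅ ws) refl eq with _ , refl ← unpunch v (used pw) =
    (e , pa , pw) ◅ restrict ws refl eq
  edge′ : ∀ {i j} → _ → ∃[ a ] ∃[ b ] part i (punchIn v a) × part j (punchIn v b) × punchIn v a ~ punchIn v b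
  edge′ h with u , w , pu , pw , e ← edge h
          with a , refl ← unpunch v (used pu) | b , refl ← unpunch v (used pw) = a , b , pu , pw , e

-- The map `merge` sends `v` to the vertex that stands for `u` and fixes the rest. Since both ends
-- lie in one branch set, it respects branch sets, and it maps each edge to an edge or to a single
-- vertex.
model-contractEdge : ∀ {k n} {H : Graph k} {G : Graph (suc n)} (M : Model H G) u v
  (e : Graph._~_ G u v) {i} → Model.part M i u → Model.part M i v → Model H (contractEdge G u v e)
model-contractEdge {n = n} {H} {G} M u v uv {i₀} pu pv = record
  { part      = λ i a → part i (punchIn v a)
  ; part?     = λ i a → part? i (punchIn v a)
  ; disjoint  = disjoint
  ; nonempty  = λ i → let w , pw = nonempty i in merge w , part-merge pw
  ; connected = λ i pa pb →
      subst₂ (Star _) (merge-punchIn _) (merge-punchIn _)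
        (Star.kleisliStar merge step (connected i pa pb))
  ; edge      = λ h → let x , y , px , py , e = edge h in
      merge x , merge y , part-merge px , part-merge py ,
      -- An edge between the branch sets of adjacent vertices of `H` cannot collapse: by
      -- disjointness the two vertices of `H` would coincide.
      [ (λ eq → contradiction h (Graph.~-irrefl H
          (disjoint (part-merge px) (subst (λ a → part _ (punchIn v a)) (sym eq) (part-merge py))))) , id ]′
        (merge-~ e)
  }
  where
  open Model M
  open Graph G
  G′ : Graph n
  G′ = contractEdge G u v uv
  locate : ∀ w → ∃[ a ] (punchIn v a ≡ w ⊎ (w ≡ v × punchIn v a ≡ u))
  locate w with w ≟ v
  ... | no w≢v   = let a , eq = unpunch v w≢v in a , inj₁ eq
  ... | yes refl = let a , eq = unpunch v (λ u≡v → ~-irrefl u≡v uv) in a , inj₂ (refl , eq)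
  merge : Fin (suc n) → Fin n
  merge w = proj₁ (locate w)
  merge-punchIn : ∀ a → merge (punchIn v a) ≡ a
  merge-punchIn a with locate (punchIn v a)
  ... | b , inj₁ eq       = punchIn-injective v b a eq
  ... | b , inj₂ (eq , _) = contradiction eq (punchInᵢ≢i v a)
  part-merge : ∀ {i w} → part i w → part i (punchIn v (merge w))
  part-merge {w = w} pw with locate w
  ... | b , inj₁ eq          = subst (part _) (sym eq) pw
  ... | b , inj₂ (refl , eq) with refl ← disjoint pv pw = subst (part _) (sym eq) pu
  merge-~ : ∀ {x y} → x ~ y → merge x ≡ merge y ⊎ Graph._~_ G′ (merge x) (merge y)
  merge-~ {x} {y} e with merge x ≟ merge y
  ... | yes eq = inj₁ eq
  ... | no neq with locate x | locate y
  ... | a , inj₁ refl        | b , inj₁ refl        = inj₂ (neq , inj₁ e)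
  ... | a , inj₁ refl        | b , inj₂ (refl , eq) = inj₂ (neq , inj₂ (inj₂ (eq , ~-sym e)))
  ... | a , inj₂ (refl , eq) | b , inj₁ refl        = inj₂ (neq , inj₂ (inj₁ (eq , e)))
  ... | a , inj₂ (refl , _)  | b , inj₂ (refl , _)  = contradiction e (~-irrefl refl)
  step : ∀ {i x y} → Within G (part i) x y →
         Star (Within G′ (λ a → part i (punchIn v a))) (merge x) (merge y)
  step {x = x} {y} (e , px , py) with merge-~ e
  ... | inj₁ eq = subst (Star _ (merge x)) eq ε
  ... | inj₂ e′ = (e′ , part-merge px , part-merge py) ◅ ε

-- Induction on the number of vertices of `G`. A vertex outside all branch sets is deleted, and an
-- edge inside a branch set is contracted. If there is neither, the branch sets cover `G` and, being
-- connected without inner edges, are singletons, so `G` has the vertices of `H`.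
model⇒minor : ∀ {k n} {H : Graph k} {G : Graph n} → Model H G → H IsMinorOf G
model⇒minor {k} {n} {H} {G} M
  with any? (λ v → ¬? (any? (λ i → Model.part? M i v)))
     | any? (λ u → any? (λ v → Graph._~?_ G u v ×-dec any? (λ i → Model.part? M i u ×-dec Model.part? M i v)))
model⇒minor {n = suc n} M | yes (v , unused) | _ =
  del-v v (model⇒minor (model-deleteVertex M v (λ i pv → unused (i , pv))))
model⇒minor {n = suc n} M | no _ | yes (u , v , e , i , pu , pv) =
  contr u v e (model⇒minor (model-contractEdge M u v e pu pv))
model⇒minor {k} {n} {H} {G} M | no spans | no discrete =
  spanning⇒minor H G (mk↔ₛ′ rep cls rep-cls cls-rep) λ h →
    let u , v , pu , pv , e = edge h in
    subst₂ _~_ (singleton pu (proj₂ (nonempty _))) (singleton pv (proj₂ (nonempty _))) e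
  where
  open Model M
  open Graph G
  covered : ∀ v → ∃[ i ] part i v
  covered v = decidable-stable (any? (λ i → part? i v)) (λ ¬c → spans (v , ¬c))
  singleton : ∀ {i u v} → part i u → part i v → u ≡ v
  singleton pu pv with connected _ pu pv
  ... | ε = refl
  ... | (e , pa , pb) ◅ _ = contradiction (_ , _ , e , _ , pa , pb) discrete
  rep : Fin k → Fin n
  rep i = proj₁ (nonempty i)
  cls : Fin n → Fin k
  cls v = proj₁ (covered v)
  rep-cls : ∀ v → rep (cls v) ≡ v
  rep-cls v = singleton (proj₂ (nonempty (cls v))) (proj₂ (covered v))
  cls-rep : ∀ i → cls (rep i) ≡ i
  cls-rep i = disjoint (proj₂ (covered (rep i))) (proj₂ (nonempty i))

module _ {n} (G : Graph n) where
  open Graph G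

  -- The branch sets are `X` and `R` for the part of size two and the singletons of the `ℓ k` for
  -- the other part.
  K₂-minor : ∀ {t} {X R : Subset n} (ℓ : Fin t → Fin n) →
    ConnectedOn G (_∈ X) → ConnectedOn G (_∈ R) → ∃ (_∈ X) → ∃ (_∈ R) →
    (∀ {v} → v ∈ X → v ∉ R) → Injective _≡_ _≡_ ℓ →
    (∀ k → ℓ k ∉ X) → (∀ k → ℓ k ∉ R) →
    (∀ k → ∃[ x ] x ∈ X × x ~ ℓ k) → (∀ k → ∃[ r ] r ∈ R × r ~ ℓ k) →
    K 2 t IsMinorOf G
  K₂-minor {t} {X} {R} ℓ X-conn R-conn X-ne R-ne X∩R=∅ ℓ-inj ℓ∉X ℓ∉R toX toR = model⇒minor (record
    { part      = part
    ; part?     = λ { zero v → v ∈? X ; (suc zero) v → v ∈? R ; (suc (suc k)) v → ℓ k ≟ v }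
    ; disjoint  = disjoint _ _
    ; nonempty  = λ { zero → X-ne ; (suc zero) → R-ne ; (suc (suc k)) → ℓ k , refl }
    ; connected = λ { zero → X-conn ; (suc zero) → R-conn ; (suc (suc k)) refl refl → ε }
    ; edge      = edge _ _
    })
    where
    part : Fin (2 + t) → Pred (Fin n) 0ℓ
    part zero          v = v ∈ X
    part (suc zero)    v = v ∈ R
    part (suc (suc k)) v = ℓ k ≡ v
    disjoint : ∀ i j {v} → part i v → part j v → i ≡ j
    disjoint zero          zero          _    _    = refl
    disjoint zero          (suc zero)    p    q    = contradiction q (X∩R=∅ p)
    disjoint zero          (suc (suc k)) p    refl = contradiction p (ℓ∉X k)
    disjoint (suc zero)    zero          p    q    = contradiction p (X∩R=∅ q)
    disjoint (suc zero)    (suc zero)    _    _    = refl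
    disjoint (suc zero)    (suc (suc k)) p    refl = contradiction p (ℓ∉R k)
    disjoint (suc (suc k)) zero          refl q    = contradiction q (ℓ∉X k)
    disjoint (suc (suc k)) (suc zero)    refl q    = contradiction q (ℓ∉R k)
    disjoint (suc (suc k)) (suc (suc l)) refl q    = cong (λ m → suc (suc m)) (ℓ-inj (sym q))
    edge : ∀ i j → Graph._~_ (K 2 t) i j → ∃[ u ] ∃[ v ] part i u × part j v × u ~ v
    edge zero          (suc (suc k)) _ = let x , x∈X , e = toX k in x , ℓ k , x∈X , refl , e
    edge (suc zero)    (suc (suc k)) _ = let r , r∈R , e = toR k in r , ℓ k , r∈R , refl , e
    edge (suc (suc k)) zero          _ = let x , x∈X , e = toX k in ℓ k , x , refl , x∈X , ~-sym e
    edge (suc (suc k)) (suc zero)    _ = let r , r∈R , e = toR k in ℓ k , r , refl , r∈R , ~-sym e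
    edge zero          zero          (inj₁ (_ , ()))
    edge zero          zero          (inj₂ (() , _))
    edge zero          (suc zero)    (inj₁ (_ , s≤s ()))
    edge zero          (suc zero)    (inj₂ (() , _))
    edge (suc zero)    zero          (inj₁ (_ , ()))
    edge (suc zero)    zero          (inj₂ (s≤s () , _))
    edge (suc zero)    (suc zero)    (inj₁ (_ , s≤s ()))
    edge (suc zero)    (suc zero)    (inj₂ (s≤s () , _))
    edge (suc (suc k)) (suc (suc l)) (inj₁ (s≤s (s≤s ()) , _))
    edge (suc (suc k)) (suc (suc l)) (inj₂ (_ , s≤s (s≤s ())))

-- The game as a reachability problem

module _ {n} (G : Graph n) where
  open Graph G
  open Game G

  move? : ∀ u v → Dec (Move u v)
  move? u v = (u ≟ v) ⊎-dec (u ~? v)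

  -- Positions with the cops to move from which they can force a capture.
  data Win {m} (c : Vector (Fin n) m) (r : Fin n) : Set where
    catch : ∀ i → Move (c i) r → Win c r
    step  : ∀ c′ → (∀ i → Move (c i) (c′ i)) → (∀ {r′} → Move r r′ → Win c′ r′) → Win c r

  infixl 6 _[_↦_]
  _[_↦_] : ∀ {m} → Vector (Fin n) m → Fin m → Fin n → Vector (Fin n) m
  c [ i ↦ y ] = updateAt c i (const y)

  legal-update : ∀ {m} {c : Vector (Fin n) m} {i y} → Move (c i) y → ∀ j → Move (c j) ((c [ i ↦ y ]) j)
  legal-update {c = c} {i} mv j with j ≟ i
  ... | yes refl = subst (Move (c i)) (sym (updateAt-updates i c)) mv
  ... | no j≢i   = inj₁ (sym (updateAt-minimal j i c j≢i))

  -- Placements are functions that survive encoding and decoding only pointwise, so `Win` has to be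
  -- transported along pointwise equality.
  Win-resp-≗ : ∀ {m} {c d : Vector (Fin n) m} {r} → c ≗ d → Win c r → Win d r
  Win-resp-≗ c≗d (catch i mv)      = catch i (subst (λ x → Move x _) (c≗d i) mv)
  Win-resp-≗ c≗d (step c′ legal k) = step c′ (λ i → subst (λ x → Move x _) (c≗d i) (legal i)) k

  module _ {m : ℕ} where

    -- Positions become elements of a finite type, the robber in entry zero, so that sets of
    -- positions are of type `Subset` and can be saturated.
    encode : Fin n → Vector (Fin n) m → Fin (n ^ suc m)
    encode r c = funToFin (r ∷ᵛ c)

    robber : Fin (n ^ suc m) → Fin n
    robber x = finToFun {n} {suc m} x zero

    cops : Fin (n ^ suc m) → Vector (Fin n) m
    cops x i = finToFun {n} {suc m} x (suc i)

    robber-encode : ∀ r c → robber (encode r c) ≡ r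
    robber-encode r c = finToFun-funToFin (r ∷ᵛ c) zero

    cops-encode : ∀ r c → cops (encode r c) ≗ c
    cops-encode r c i = finToFun-funToFin (r ∷ᵛ c) (suc i)

    -- Backward analysis of the finite game: the saturated set `S` of positions consists of wins by
    -- soundness, and contains every win by induction on the derivation.
    Win? : ∀ (c : Vector (Fin n) m) r → Dec (Win c r)
    Win? c r = map′ (λ x∈S → decoded (S⊆Q x∈S)) complete (encode r c ∈? S)
      where
      Step : Subset (n ^ suc m) → Pred (Fin (n ^ suc m)) 0ℓ
      Step S x = (∃[ i ] Move (cops x i) (robber x)) ⊎
                 (∃[ y ] (∀ i → Move (cops x i) (finToFun {n} {m} y i)) ×
                         (∀ r′ → Move (robber x) r′ → encode r′ (finToFun y) ∈ S))
      Q : Pred (Fin (n ^ suc m)) 0ℓ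
      Q x = Win (cops x) (robber x)
      decoded : ∀ {r c} → Q (encode r c) → Win c r
      decoded {r} {c} w = subst (Win c) (robber-encode r c) (Win-resp-≗ (cops-encode r c) w)
      Step? : ∀ S → Decidable (Step S)
      Step? S x =
        any? (λ i → move? (cops x i) (robber x)) ⊎-dec
        any? (λ y → all? (λ i → move? (cops x i) (finToFun {n} {m} y i)) ×-dec
                    all? (λ r′ → move? (robber x) r′ →-dec (encode r′ (finToFun y) ∈? S)))
      sound : ∀ S → (∀ {x} → x ∈ S → Q x) → ∀ {x} → Step S x → Q x
      sound S S⊆Q (inj₁ (i , mv))        = catch i mv
      sound S S⊆Q (inj₂ (y , legal , k)) = step (finToFun y) legal (λ mv → decoded (S⊆Q (k _ mv)))
      saturated : ∃[ S ] (∀ {x} → x ∈ S → Q x) × (∀ {x} → Step S x → x ∈ S)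
      saturated = saturate Step? sound
      S : Subset (n ^ suc m)
      S = proj₁ saturated
      S⊆Q : ∀ {x} → x ∈ S → Q x
      S⊆Q = proj₁ (proj₂ saturated)
      closed : ∀ {x} → Step S x → x ∈ S
      closed = proj₂ (proj₂ saturated)
      -- Any code that decodes pointwise to the position is allowed, because the recursive call
      -- meets `c′` only after a round trip through its code.
      complete′ : ∀ {c r} → Win c r → ∀ x → cops x ≗ c → robber x ≡ r → x ∈ S
      complete′ (catch i mv) x ceq refl =
        closed (inj₁ (i , subst (λ u → Move u _) (sym (ceq i)) mv))
      complete′ (step c′ legal k) x ceq refl = closed (inj₂
        ( funToFin c′
        , (λ i → subst₂ Move (sym (ceq i)) (sym (finToFun-funToFin c′ i)) (legal i))
        , (λ r′ mv → complete′ (k mv) _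
             (λ i → trans (cops-encode r′ _ i) (finToFun-funToFin c′ i)) (robber-encode r′ _))))
      complete : ∀ {c r} → Win c r → encode r c ∈ S
      complete {c} {r} w = complete′ w _ (cops-encode r c) (robber-encode r c)

    -- The cops remember the winning derivation that remains; there is none after a
    -- capture or an illegal move of the robber.
    Plan : Set
    Plan = ∃[ c ] (∀ r → Maybe (Win {m} c r))

    follow : ∀ {c r} → Maybe (Win {m} c r) → Plan
    follow {r = r} (just (step c′ _ k))  = c′ , λ r′ → Maybe.map k (dec⇒maybe (move? r r′))
    follow {c} {r} (just (catch i _))    = c [ i ↦ r ] , λ _ → nothing
    follow {c}     nothing               = c , λ _ → nothing

    follow-legal : ∀ {c r} (w : Maybe (Win {m} c r)) → ∀ i → Move (c i) (proj₁ (follow w) i)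
    follow-legal (just (step _ legal _)) = legal
    follow-legal (just (catch _ mv))     = legal-update mv
    follow-legal nothing                 = λ _ → inj₁ refl

    -- Each round descends to a subderivation of the win. Derivations are well-founded, so against a
    -- legal robber a `catch` is reached.
    Win⇒CopsWin : ∀ c → (∀ r → Win c r) → CopsWin m
    Win⇒CopsWin c win = σ , λ r play → captured r play 0 refl (win (r 0)) refl
      where
      plan : List (Fin n) → Plan
      plan []      = c , just ∘ win
      plan (r ∷ h) = follow (proj₂ (plan h) r)
      σ : Strategy m
      σ = record { position = proj₁ ∘ plan ; legal = λ r h → follow-legal (proj₂ (plan h) r) }
      captured : ∀ r → RobberPlay r → ∀ k {d g} → plan (history r k) ≡ (d , g) →
                 (w : Win d (r k)) → g (r k) ≡ just w → Captured σ r
      captured r play k {d} {g} planned w eq = continue w advance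
        where
        advance : plan (history r (suc k)) ≡ follow (just w)
        advance = trans (cong (λ P → follow (proj₂ P (r k))) planned) (cong follow eq)
        continue : (w : Win d (r k)) → plan (history r (suc k)) ≡ follow (just w) → Captured σ r
        continue (catch i mv) adv = k , i , inj₂ (trans (cong (λ P → proj₁ P i) adv) (updateAt-updates i d))
        -- The robber's move is legal, so the test in `follow` succeeds and the plan holds exactly
        -- the subderivation `f mv`.
        continue (step c′ legal f) adv with move? (r k) (r (suc k)) in eq′
        ... | no ¬mv = contradiction (play k) ¬mv
        ... | yes mv = captured r play (suc k) adv (f mv) (cong (Maybe.map f ∘ dec⇒maybe) eq′)

    -- By contraposition, as `Win` is decidable: from a position that is not a win, whatever the
    -- strategy answers, some robber move again leads to such a position. Repeating this gives an
    -- infinite play without capture, since any capture would make the position before it a win by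
    -- `catch`.
    CopsWin⇒Win : ((σ , _) : CopsWin m) → ∀ r → Win (Strategy.position σ []) r
    CopsWin⇒Win (σ , winning) r₀ =
      decidable-stable (Win? _ r₀) λ lost → escape lost (winning (robberAt lost) (play lost))
      where
      open Strategy σ
      Lost : Pred (List (Fin n) × Fin n) 0ℓ
      Lost (h , r) = ¬ Win (position h) r
      evade : ∀ h r → Lost (h , r) → ∃[ r′ ] Move r r′ × Lost (r ∷ h , r′)
      evade h r lost = decidable-stable
        (any? (λ r′ → move? r r′ ×-dec ¬? (Win? (position (r ∷ h)) r′)))
        λ none → lost (step (position (r ∷ h)) (legal r h) λ {r′} mv →
          decidable-stable (Win? (position (r ∷ h)) r′) (λ ¬w → none (r′ , mv , ¬w)))
      module _ (lost : Lost ([] , r₀)) where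
        state : ℕ → ∃ Lost
        state zero    = ([] , r₀) , lost
        state (suc k) = let ((h , r) , l) = state k; r′ , _ , l′ = evade h r l in (r ∷ h , r′) , l′
        robberAt : ℕ → Fin n
        robberAt k = proj₂ (proj₁ (state k))
        play : RobberPlay robberAt
        play k = let ((h , r) , l) = state k in proj₁ (proj₂ (evade h r l))
        state-history : ∀ k → proj₁ (proj₁ (state k)) ≡ history robberAt k
        state-history zero    = refl
        state-history (suc k) = cong (robberAt k ∷_) (state-history k)
        lostAt : ∀ k → Lost (history robberAt k , robberAt k)
        lostAt k = subst (λ h → Lost (h , robberAt k)) (state-history k) (proj₂ (state k))
        escape : ¬ Captured σ robberAt
        escape (k , i , inj₁ eq) = lostAt k (catch i (inj₁ eq))
        escape (k , i , inj₂ eq) = lostAt k (catch i (subst (Move _) eq (legal _ _ i)))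

    -- Strategies are infinite objects, but it suffices to search the finitely many initial
    -- placements for one that wins against every start of the robber. This makes the least number
    -- of cops computable.
    CopsWin? : Dec (CopsWin m)
    CopsWin? = map′
      (λ (y , win) → Win⇒CopsWin (finToFun {n} {m} y) win)
      (λ cw@(σ , _) → funToFin (Strategy.position σ []) , λ r →
        Win-resp-≗ (λ i → sym (finToFun-funToFin (Strategy.position σ []) i)) (CopsWin⇒Win cw r))
      (any? (λ y → all? (λ r → Win? (finToFun {n} {m} y) r)))

  -- Besieging the robber

  Boundary : Subset n → Pred (Fin n) 0ℓ
  Boundary R b = b ∉ R × ∃[ r ] r ∈ R × r ~ b

  boundary? : ∀ R → Decidable (Boundary R)
  boundary? R b = ¬? (b ∈? R) ×-dec any? (λ r → (r ∈? R) ×-dec (r ~? b))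

  exit : ∀ {R u v} → Star _~_ u v → u ∈ R → v ∉ R → ∃ (Boundary R)
  exit ε u∈R u∉R = contradiction u∈R u∉R
  exit {R} (_◅_ {j = w} e ws) u∈R v∉R with w ∈? R
  ... | yes w∈R = exit ws w∈R v∉R
  ... | no w∉R  = w , w∉R , _ , u∈R , e

  -- The robber is confined to R; cop a b answers for the boundary vertex b.
  record Siege {m} (c : Vector (Fin n) m) (a : Fin n → Fin m) (X R : Subset n) : Set where
    field
      X-connected : ConnectedOn G (_∈ X)
      R-connected : ConnectedOn G (_∈ R)
      X-nonempty  : ∃ (_∈ X)
      X∩R=∅       : ∀ {v} → v ∈ X → v ∉ R
      guarded     : ∀ {b} → Boundary R b → b ∉ X × c (a b) ∈ X × c (a b) ~ b

  -- Placement, assignment and `X` all vary, so that this serves as an induction hypothesis on `R`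
  -- alone.
  Beaten : ℕ → Subset n → Set
  Beaten m R = ∀ {c : Vector (Fin n) m} {a X} → Siege c a X R → ∀ {r} → r ∈ R → Win c r

  module _ {m} {a : Fin n → Fin m} {X R : Subset n} where

    -- Cop `i` has just reached `y` and the robber has replied. A robber who left `R` stands on `y`
    -- or on a vertex guarded by another cop; one who stayed next to `y` is caught by cop `i`.
    -- Otherwise the siege continues around a smaller territory.
    press : (∀ {R′} → R′ ⊂ R → Beaten m R′) →
            ∀ {c i y} → Siege c a X R → Boundary R y →
            (∀ {b} → Boundary R b → b ≢ y → a b ≢ i) →
            ∀ {r r′} → r ∈ R → Move r r′ → Win (c [ i ↦ y ]) r′
    press smaller {c} {i} {y} siege By@(y∉R , s , s∈R , s~y) others {r} {r′} r∈R mv with r′ ∈? R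
    ... | no r′∉R with r′ ≟ y
    ...   | yes refl = catch i (inj₁ (updateAt-updates i c))
    ...   | no r′≢y  = catch (a r′) (inj₂ (subst (_~ r′) (sym (updateAt-minimal (a r′) i c (others Br′ r′≢y)))
                                            (proj₂ (proj₂ (Siege.guarded siege Br′)))))
      where
      Br′ : Boundary R r′
      Br′ = r′∉R , r , r∈R , [ (λ { refl → contradiction r∈R r′∉R }) , id ]′ mv
    press smaller {c} {i} {y} siege By@(y∉R , s , s∈R , s~y) others {r} {r′} r∈R mv | yes r′∈R with y ~? r′
    ... | yes y~r′ = catch i (inj₂ (subst (_~ r′) (sym (updateAt-updates i c)) y~r′))
    ... | no y≁r′
      with R′ , r′∈R′ , R′⊆ , R′-conn , maximal ← component G (λ v → (v ∈? R) ×-dec ¬? (y ~? v)) (r′∈R , y≁r′)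
      -- The inclusion is strict because `s`, a neighbour of `y` in `R`, is lost.
      = smaller (proj₁ ∘ R′⊆ , s , s∈R , λ s∈R′ → proj₂ (R′⊆ s∈R′) (~-sym s~y)) siege′ r′∈R′
      where
      open Siege siege
      X′ : Subset n
      X′ = X ∪ ⁅ y ⁆
      -- A boundary vertex of `R′` inside `R` is adjacent to `y` by maximality, so cop `i` takes it.
      -- One outside `R` was on the old boundary and differs from `y`, so its old cop has not moved.
      a′ : Fin n → Fin m
      a′ b = if does (b ∈? R) then i else a b
      X⊆X′ : ∀ {v} → v ∈ X → v ∈ X′
      X⊆X′ v∈X = x∈p∪q⁺ (inj₁ v∈X)
      y∈X′ : y ∈ X′
      y∈X′ = x∈p∪q⁺ (inj₂ (x∈⁅x⁆ y))
      X′-split : ∀ {v} → v ∈ X′ → v ∈ X ⊎ v ≡ y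
      X′-split v∈X′ = [ inj₁ , inj₂ ∘ x∈⁅y⁆⇒x≡y y ]′ (x∈p∪q⁻ X ⁅ y ⁆ v∈X′)
      -- The vertex from which `y` was guarded before the move lies in `X` and is adjacent to `y`,
      -- so it links `y` to `X`.
      reach : ∀ {v} → v ∈ X′ → Star (Within G (_∈ X′)) (c (a y)) v
      reach v∈X′ with X′-split v∈X′ | guarded By
      ... | inj₁ v∈X  | _ , h∈X , _ = Star.map (λ (e , p , q) → e , X⊆X′ p , X⊆X′ q) (X-connected h∈X v∈X)
      ... | inj₂ refl | _ , h∈X , e = (e , X⊆X′ h∈X , y∈X′) ◅ ε
      guarded′ : ∀ {b} → Boundary R′ b → b ∉ X′ × (c [ i ↦ y ]) (a′ b) ∈ X′ × (c [ i ↦ y ]) (a′ b) ~ b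
      guarded′ {b} (b∉R′ , u , u∈R′ , u~b) with b ∈? R
      ... | yes b∈R rewrite updateAt-updates i {const y} c =
        (λ b∈X′ → [ (λ b∈X → X∩R=∅ b∈X b∈R) , (λ { refl → y∉R b∈R }) ]′ (X′-split b∈X′))
        , y∈X′
        , decidable-stable (y ~? b) (λ y≁b → b∉R′ (maximal u∈R′ u~b (b∈R , y≁b)))
      ... | no b∉R
        with b≢y ← (λ { refl → proj₂ (R′⊆ u∈R′) (~-sym u~b) })
        with Bb ← (b∉R , u , proj₁ (R′⊆ u∈R′) , u~b)
        with b∉X , h∈X , h~b ← guarded Bb
        rewrite updateAt-minimal (a b) i {const y} c (others Bb b≢y) =
        (λ b∈X′ → [ b∉X , b≢y ]′ (X′-split b∈X′)) , X⊆X′ h∈X , h~b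
      siege′ : Siege (c [ i ↦ y ]) a′ X′ R′
      siege′ = record
        { X-connected = hub⇒connectedOn G (c (a y)) reach
        ; R-connected = R′-conn
        ; X-nonempty  = y , y∈X′
        ; X∩R=∅       = λ v∈X′ v∈R′ →
            [ (λ v∈X → X∩R=∅ v∈X (proj₁ (R′⊆ v∈R′))) , (λ { refl → y∉R (proj₁ (R′⊆ v∈R′)) }) ]′ (X′-split v∈X′)
        ; guarded     = guarded′
        }

    -- Cop `i` guards nothing, so the siege holds while it walks to `y`, and a robber who leaves `R`
    -- meanwhile is caught.
    travel : (∀ {R′} → R′ ⊂ R → Beaten m R′) →
             ∀ {c i y z} → Siege c a X R → Boundary R y → (∀ {b} → Boundary R b → a b ≢ i) →
             c i ≡ z → Star _~_ z y → ∀ {r} → r ∈ R → Win c r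
    travel smaller {c} {i} {y} siege By idle refl ε r∈R =
      -- On arrival all cops stay put for one turn, since `press` starts after a reply of the
      -- robber.
      step (c [ i ↦ y ]) (legal-update (inj₁ refl)) (press smaller siege By (λ Bb _ → idle Bb) r∈R)
    travel smaller {c} {i} siege By idle refl (_◅_ {j = w} e ws) {r} r∈R =
      step (c [ i ↦ w ]) (legal-update (inj₂ e)) proceed
      where
      open Siege siege
      guarded′ : ∀ {b} → Boundary R b → b ∉ X × (c [ i ↦ w ]) (a b) ∈ X × (c [ i ↦ w ]) (a b) ~ b
      guarded′ {b} Bb rewrite updateAt-minimal (a b) i {const w} c (idle Bb) = guarded Bb
      proceed : ∀ {r′} → Move r r′ → Win (c [ i ↦ w ]) r′
      proceed {r′} mv with r′ ∈? R
      ... | yes r′∈R = travel smaller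
        (record { X-connected = X-connected ; R-connected = R-connected ; X-nonempty = X-nonempty
                ; X∩R=∅ = X∩R=∅ ; guarded = guarded′ })
        By idle (updateAt-updates i c) ws r′∈R
      ... | no r′∉R = catch (a r′) (inj₂ (proj₂ (proj₂ (guarded′
        (r′∉R , r , r∈R , [ (λ { refl → contradiction r∈R r′∉R }) , id ]′ mv)))))

  -- Counting boundary vertices and induction on the territory

  module _ {t m} (connected : Connected G) (free : K 2 t -MinorFree G) (t≤m+m : t ≤ m + m) where

    Leaf : ∀ (a : Fin n → Fin m) R → Fin m → Pred (Fin n) 0ℓ
    Leaf a R i b = Boundary R b × a b ≡ i

    leaf? : ∀ a R i → Decidable (Leaf a R i)
    leaf? a R i b = boundary? R b ×-dec (a b ≟ i)

    TwoLeaves : (Fin n → Fin m) → Subset n → Pred (Fin m) 0ℓ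
    TwoLeaves a R i = ∃[ b ] ∃[ b′ ] Leaf a R i b × Leaf a R i b′ × b ≢ b′

    twoLeaves? : ∀ a R → Decidable (TwoLeaves a R)
    twoLeaves? a R i = any? (λ b → any? (λ b′ → leaf? a R i b ×-dec leaf? a R i b′ ×-dec ¬? (b ≟ b′)))

    -- Two boundary vertices per cop would be `m + m` in total, all distinct because each is
    -- assigned to only one cop. Any `t` of them complete a `K 2 t` minor with `X` and `R`.
    ¬all-twoLeaves : ∀ {c : Vector (Fin n) m} {a X R r} → Siege c a X R → r ∈ R → ¬ (∀ i → TwoLeaves a R i)
    ¬all-twoLeaves {c} {a} {X} {R} siege r∈R two = free (K₂-minor G ℓ X-connected R-connected X-nonempty (_ , r∈R)
      X∩R=∅ ℓ-injective (λ k → proj₁ (guarded (ℓ-boundary k))) (λ k → proj₁ (ℓ-boundary k))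
      (λ k → _ , proj₂ (guarded (ℓ-boundary k))) (λ k → proj₂ (ℓ-boundary k)))
      where
      open Siege siege
      pick : Fin m ⊎ Fin m → Fin n
      pick (inj₁ i) = proj₁ (two i)
      pick (inj₂ i) = proj₁ (proj₂ (two i))
      owner : Fin m ⊎ Fin m → Fin m
      owner = [ id , id ]′
      pick-leaf : ∀ x → Leaf a R (owner x) (pick x)
      pick-leaf (inj₁ i) = proj₁ (proj₂ (proj₂ (two i)))
      pick-leaf (inj₂ i) = proj₁ (proj₂ (proj₂ (proj₂ (two i))))
      same-owner : ∀ x y → pick x ≡ pick y → owner x ≡ owner y
      same-owner x y eq = trans (sym (proj₂ (pick-leaf x))) (trans (cong a eq) (proj₂ (pick-leaf y)))
      pick-injective : ∀ x y → pick x ≡ pick y → x ≡ y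
      pick-injective x y eq with same-owner x y eq
      pick-injective (inj₁ i) (inj₁ i) eq | refl = refl
      pick-injective (inj₁ i) (inj₂ i) eq | refl = contradiction eq (proj₂ (proj₂ (proj₂ (proj₂ (two i)))))
      pick-injective (inj₂ i) (inj₁ i) eq | refl = contradiction (sym eq) (proj₂ (proj₂ (proj₂ (proj₂ (two i)))))
      pick-injective (inj₂ i) (inj₂ i) eq | refl = refl
      slot : Fin t → Fin m ⊎ Fin m
      slot k = splitAt m (inject≤ k t≤m+m)
      ℓ : Fin t → Fin n
      ℓ k = pick (slot k)
      ℓ-injective : Injective _≡_ _≡_ ℓ
      ℓ-injective {k} {l} eq = inject≤-injective t≤m+m t≤m+m k l
        (trans (sym (join-splitAt m m _)) (trans (cong (join m m) (pick-injective (slot k) (slot l) eq)) (join-splitAt m m _)))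
      ℓ-boundary : ∀ k → Boundary R (ℓ k)
      ℓ-boundary k = proj₁ (pick-leaf (slot k))

    beaten : ∀ R → Acc _⊂_ R → Beaten m R
    beaten R (acc rec) {c} {a} siege {r} r∈R
      with i , few ← ¬∀⟶∃¬ m (TwoLeaves a R) (twoLeaves? a R) (¬all-twoLeaves siege r∈R)
      with any? (leaf? a R i)
    ... | yes (y , By , refl) =
      step (c [ i ↦ y ]) (legal-update (inj₂ (proj₂ (proj₂ (Siege.guarded siege By)))))
        (press (λ R′⊂R → beaten _ (rec R′⊂R)) siege By
          -- A further boundary vertex of cop `i` would give it two.
          (λ Bb b≢y ab≡i → few (_ , y , (Bb , ab≡i) , (By , refl) , b≢y)) r∈R)
    ... | no idle =
      let x , x∈X = Siege.X-nonempty siege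
          -- The boundary is nonempty because a walk from the robber to `X` has to leave `R`.
          y , By  = exit (connected r x) r∈R (Siege.X∩R=∅ siege x∈X)
      in travel (λ R′⊂R → beaten _ (rec R′⊂R)) siege By (λ Bb ab≡i → idle (_ , Bb , ab≡i)) refl (connected _ y) r∈R

    -- All cops start at `x`, and `R` is the robber's component outside the closed neighbourhood of
    -- `x`. By maximality its boundary consists of neighbours of `x`, so a single cop `i` can answer
    -- for all of it.
    copsWin : Fin n → Fin m → CopsWin m
    copsWin x i = Win⇒CopsWin (const x) win
      where
      win : ∀ r → Win (const x) r
      win r with move? x r
      ... | yes mv = catch i mv
      ... | no ¬mv
        with R , r∈R , R⊆ , R-conn , maximal ← component G (λ v → ¬? (move? x v)) ¬mv
        = beaten R (⊂-wellFounded R) siege r∈R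
        where
        guarded : ∀ {b} → Boundary R b → b ∉ ⁅ x ⁆ × x ∈ ⁅ x ⁆ × x ~ b
        guarded {b} (b∉R , s , s∈R , s~b) with move? x b
        ... | no ¬mv          = contradiction (maximal s∈R s~b ¬mv) b∉R
        ... | yes (inj₁ refl) = contradiction (inj₂ (~-sym s~b)) (R⊆ s∈R)
        ... | yes (inj₂ x~b)  = (λ b∈ → ~-irrefl (sym (x∈⁅y⁆⇒x≡y x b∈)) x~b) , x∈⁅x⁆ x , x~b
        siege : Siege (const x) (const i) ⁅ x ⁆ R
        siege = record
          { X-connected = λ u∈ v∈ → subst₂ (Star _) (sym (x∈⁅y⁆⇒x≡y x u∈)) (sym (x∈⁅y⁆⇒x≡y x v∈)) ε
          ; R-connected = R-conn
          ; X-nonempty  = x , x∈⁅x⁆ x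
          ; X∩R=∅       = λ v∈ v∈R → R⊆ v∈R (inj₁ (sym (x∈⁅y⁆⇒x≡y x v∈)))
          ; guarded     = guarded
          }

-- The bound on the cop number

m≤⌈m+1/2⌉+⌈m+1/2⌉ : ∀ m → m ≤ ⌈ m + 1 /2⌉ + ⌈ m + 1 /2⌉
m≤⌈m+1/2⌉+⌈m+1/2⌉ m = begin
  m                             ≤⟨ m≤m+n m 1 ⟩
  m + 1                         ≡⟨ ⌊n/2⌋+⌈n/2⌉≡n (m + 1) ⟨
  ⌊ m + 1 /2⌋ + ⌈ m + 1 /2⌉     ≤⟨ +-monoˡ-≤ ⌈ m + 1 /2⌉ (⌊n/2⌋≤⌈n/2⌉ (m + 1)) ⟩
  ⌈ m + 1 /2⌉ + ⌈ m + 1 /2⌉     ∎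
  where open ≤-Reasoning

corollary5p5 : ∀ (t : ℕ) → 1 ≤ t →
    ∀ {n : ℕ} (G : Graph n) → Connected G → K 2 t -MinorFree G →
    ∃[ c ] (IsCopNumber G c × c ≤ ⌈ t + 1 /2⌉)
corollary5p5 t 1≤t {n = zero}  G connected free =
  -- On the empty graph the robber has nowhere to start, so zero cops win.
  0 , (((record { position = λ _ () ; legal = λ _ _ () }) , λ r _ → case r 0 of λ ()) , λ _ _ → z≤n) , z≤n
corollary5p5 t 1≤t {n = suc _} G connected free =
  least (λ m → CopsWin? G {m}) ⌈ t + 1 /2⌉
    -- From `1 ≤ t` the number of cops is positive, which supplies the cop that answers for the
    -- whole first boundary.
    (copsWin G connected free (m≤⌈m+1/2⌉+⌈m+1/2⌉ t) zero (fromℕ< (⌈n/2⌉-mono (+-monoˡ-≤ 1 1≤t))))
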